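{- Consider the faulty-starter delivery problem described in the context, with finisher starting position $(x,y)$, $y\ge0$. The competitive ratio of algorithm $\mathcal{A}_0$ is $$\mathrm{CR}_{\mathcal{A}_0}=\frac{1+\sqrt{x^2+y^2}}{\max\left\{1,\sqrt{(x-1)^2+y^2}\right\}}.$$
   Context: Setting. In the plane let $S=(0,0)$ and $T=(1,0)$. A "starter" drone carrying a package starts at $S$ at time $0$ and moves at unit speed along $\overline{ST}$ towards $T$. At an unknown time $t\in[0,1]$ it fails and stays forever at $(t,0)$ with the package. A "finisher" drone starts at time $0$ at $P=(x,y)$ with $y\ge0$, moves at unit speed and can stop and turn instantaneously. The package can be handed over only when the drones are co-located; it is delivered at the first time the finisher, carrying the package, is at $T$. An online algorithm $\mathcal{A}$ specifies the finisher's trajectory using only $(x,y)$; $A(t)$ is its delivery time for fail time $t$. $\mathrm{Opt}(t)=\max\{1,\sqrt{(x-t)^2+y^2}+1-t\}$ is the optimal offline delivery time. $\mathrm{CR}_{\mathcal{A}}(t)=A(t)/\mathrm{Opt}(t)$ and $\mathrm{CR}_{\mathcal{A}}=\sup_{0\le t\le1}\mathrm{CR}_{\mathcal{A}}(t)$. Algorithm $\mathcal{A}_0$: the finisher goes straight to $S$, then moves along $\overline{ST}$ towards $T$ until it finds the package, then continues to $T$. -}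

module Defs where

open import Algebra.Bundles using (CommutativeRing)
import Algebra.Construct.NaturalChoice.Max as Max
import Algebra.Construct.NaturalChoice.Min as Min
import Algebra.Properties.Ring as RingProperties
import Algebra.Solver.Ring.NaturalCoefficients.Default as SemiringSolver
open import Data.Bool.Base using (if_then_else_)
open import Data.Product.Base using (∃; _×_; _,_; proj₁; proj₂)
open import Data.Sum.Base using (inj₁; inj₂)
open import Level using (Level; suc) renaming (_⊔_ to _⊔ˡ_)
open import Relation.Binary.Bundles using (DecTotalOrder)
open import Relation.Binary.Core using (Rel)
open import Relation.Binary.Structures using (IsDecTotalOrder)
open import Relation.Nullary.Decidable.Core using (yes; no; ⌊_⌋)
open import Relation.Nullary.Negation.Core using (¬_)

module _ {a p ℓ : Level} {A : Set a} (_≤_ : Rel A ℓ) where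

  IsUpperBound : (A → Set p) → A → Set (a ⊔ˡ p ⊔ˡ ℓ)
  IsUpperBound S b = ∀ s → S s → s ≤ b

  IsSupremum : (A → Set p) → A → Set (a ⊔ˡ p ⊔ˡ ℓ)
  IsSupremum S b = IsUpperBound S b × (∀ c → IsUpperBound S c → b ≤ c)

-- The real numbers, given by the classical axioms that determine them up to
-- isomorphism: a Dedekind-complete ordered field.
record RealNumbers (ℓ : Level) : Set (suc ℓ) where
  field
    commutativeRing : CommutativeRing ℓ ℓ

  open CommutativeRing commutativeRing public

  infix 4 _≤_

  field
    _≤_             : Rel Carrier ℓ
    isDecTotalOrder : IsDecTotalOrder _≈_ _≤_
    0≉1             : ¬ 0# ≈ 1#
    inverse         : ∀ x → ¬ x ≈ 0# → ∃ λ y → x * y ≈ 1#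
    +-monoʳ-≤       : ∀ x {y z} → y ≤ z → x + y ≤ x + z
    *-nonNegative   : ∀ {x y} → 0# ≤ x → 0# ≤ y → 0# ≤ x * y
    complete        : (S : Carrier → Set ℓ) → ∃ S → ∃ (IsUpperBound _≤_ S) →
                      ∃ (IsSupremum _≤_ S)

  decTotalOrder : DecTotalOrder ℓ ℓ ℓ
  decTotalOrder = record { isDecTotalOrder = isDecTotalOrder }

  open DecTotalOrder decTotalOrder public
    using (_≟_; _≤?_; totalOrder; total; antisym; ≤-respʳ-≈; ≤-respˡ-≈)
    renaming (refl to ≤-refl; reflexive to ≤-reflexive; trans to ≤-trans)

  open Max totalOrder public using (_⊔_)
  open Min totalOrder public using (_⊓_)

  infix  8 _⁻¹
  infixl 7 _/_

  -- 0# ⁻¹ is a dummy value.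
  _⁻¹ : Carrier → Carrier
  x ⁻¹ with x ≟ 0#
  ... | yes _   = 0#
  ... | no  x≉0 = proj₁ (inverse x x≉0)

  _/_ : Carrier → Carrier → Carrier
  x / y = x * y ⁻¹

module SquareRoot {ℓ : Level} (ℝ : RealNumbers ℓ) where
  open RealNumbers ℝ
  open RingProperties ring using (-‿distribˡ-*; -‿distribʳ-*; -‿involutive)

  private
    open SemiringSolver commutativeSemiring using (solve; _:=_; _:+_; _:*_; con)

    +-nonNegative : ∀ {x y} → 0# ≤ x → 0# ≤ y → 0# ≤ x + y
    +-nonNegative {x} 0≤x 0≤y =
      ≤-trans 0≤x (≤-respˡ-≈ (+-identityʳ x) (+-monoʳ-≤ x 0≤y))

    x≤x+δ : ∀ x {δ} → 0# ≤ δ → x ≤ x + δ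
    x≤x+δ x 0≤δ = ≤-respˡ-≈ (+-identityʳ x) (+-monoʳ-≤ x 0≤δ)

    ≤-by : ∀ {x y} δ → 0# ≤ δ → y ≈ x + δ → x ≤ y
    ≤-by {x} δ 0≤δ eq = ≤-respʳ-≈ (sym eq) (x≤x+δ x 0≤δ)

    cancel : ∀ x y → - x + (x + y) ≈ y
    cancel x y = trans (sym (+-assoc (- x) x y))
                       (trans (+-congʳ (-‿inverseˡ x)) (+-identityˡ y))

    +-cancelˡ-≤ : ∀ x {y z} → x + y ≤ x + z → y ≤ z
    +-cancelˡ-≤ x {y} {z} le =
      ≤-respˡ-≈ (cancel x y) (≤-respʳ-≈ (cancel x z) (+-monoʳ-≤ (- x) le))

    difference : ∀ {x y} → x ≤ y → ∃ λ δ → 0# ≤ δ × y ≈ x + δ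
    difference {x} {y} x≤y =
      - x + y
      , ≤-respˡ-≈ (-‿inverseˡ x) (+-monoʳ-≤ (- x) x≤y)
      , sym (trans (sym (+-assoc x (- x) y))
                   (trans (+-congʳ (-‿inverseʳ x)) (+-identityˡ y)))

    neg-square : ∀ x → - x * - x ≈ x * x
    neg-square x = trans (sym (-‿distribˡ-* x (- x)))
                         (trans (-‿cong (sym (-‿distribʳ-* x x))) (-‿involutive (x * x)))

    negation-nonNegative : ∀ {x} → x ≤ 0# → 0# ≤ - x
    negation-nonNegative {x} x≤0 =
      ≤-respˡ-≈ (-‿inverseˡ x) (≤-respʳ-≈ (+-identityʳ (- x)) (+-monoʳ-≤ (- x) x≤0))

  square-nonNegative : ∀ x → 0# ≤ x * x
  square-nonNegative x with total 0# x
  ... | inj₁ 0≤x = *-nonNegative 0≤x 0≤x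
  ... | inj₂ x≤0 = ≤-respʳ-≈ (neg-square x) (*-nonNegative 0≤-x 0≤-x)
    where 0≤-x = negation-nonNegative x≤0

  sum-of-squares-nonNegative : ∀ x y → 0# ≤ x * x + y * y
  sum-of-squares-nonNegative x y =
    +-nonNegative (square-nonNegative x) (square-nonNegative y)

  private
    0≤1 : 0# ≤ 1#
    0≤1 = ≤-respʳ-≈ (*-identityˡ 1#) (square-nonNegative 1#)

    square-zero : ∀ {x} → x * x ≈ 0# → x ≈ 0#
    square-zero {x} xx≈0 with x ≟ 0#
    ... | yes x≈0 = x≈0
    ... | no  x≉0 with inverse x x≉0
    ...   | y , xy≈1 = trans (sym (*-identityʳ x)) (trans (*-congˡ (sym xy≈1))
                       (trans (sym (*-assoc x x y)) (trans (*-congʳ xx≈0) (zeroˡ y))))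

    square-cancel-≤ : ∀ {x y} → 0# ≤ y → x * x ≤ y * y → x ≤ y
    square-cancel-≤ {x} {y} 0≤y xx≤yy with total x y
    ... | inj₁ x≤y = x≤y
    ... | inj₂ y≤x with difference y≤x
    ...   | δ , 0≤δ , x≈y+δ = ≤-reflexive (trans x≈y+δ (trans (+-congˡ δ≈0) (+-identityʳ y)))
      where
      yδ : Carrier
      yδ = y * δ + y * δ
      0≤yδ : 0# ≤ yδ
      0≤yδ = +-nonNegative (*-nonNegative 0≤y 0≤δ) (*-nonNegative 0≤y 0≤δ)
      expand : x * x ≈ y * y + (δ * δ + yδ)
      expand = trans (*-cong x≈y+δ x≈y+δ)
        (solve 2 (λ y δ → (y :+ δ) :* (y :+ δ) := y :* y :+ (δ :* δ :+ (y :* δ :+ y :* δ)))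
               refl y δ)
      δδ≤0 : δ * δ ≤ 0#
      δδ≤0 = ≤-trans (x≤x+δ (δ * δ) 0≤yδ)
        (+-cancelˡ-≤ (y * y) (≤-respˡ-≈ expand (≤-respʳ-≈ (sym (+-identityʳ (y * y))) xx≤yy)))
      δ≈0 : δ ≈ 0#
      δ≈0 = square-zero (antisym δδ≤0 (square-nonNegative δ))

  private
    expand-numerator : ∀ a r k {m} → k * k ≈ a + m →
      (a + k * r) * (a + k * r) ≈ (a + m) * (r * r) + (a * a + (a * k * r + a * k * r))
    expand-numerator a r k kk = trans
      (solve 3 (λ a r k → (a :+ k :* r) :* (a :+ k :* r)
          := k :* k :* (r :* r) :+ (a :* a :+ (a :* k :* r :+ a :* k :* r))) refl a r k)
      (+-congʳ (*-congʳ kk))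

    expand-denominator : ∀ a r k {m} → k * k ≈ a + m →
      a * ((r + k) * (r + k)) ≈ a * (r * r) + (a * (a + m) + (a * k * r + a * k * r))
    expand-denominator a r k kk = trans
      (solve 3 (λ a r k → a :* ((r :+ k) :* (r :+ k))
          := a :* (r :* r) :+ (a :* (k :* k) :+ (a :* k :* r :+ a :* k :* r))) refl a r k)
      (+-congˡ (+-congʳ (*-congˡ kk)))

    -- (a + kr)² + ma = a(r + k)² + mr²  when  k² = a + m
    balance : ∀ a r k {m} → k * k ≈ a + m →
      (a + k * r) * (a + k * r) + m * a ≈ a * ((r + k) * (r + k)) + m * (r * r)
    balance a r k {m} kk = trans (+-congʳ (expand-numerator a r k kk)) (trans
      (solve 4 (λ a q m c → (a :+ m) :* q :+ (a :* a :+ c) :+ m :* a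
          := a :* q :+ (a :* (a :+ m) :+ c) :+ m :* q)
        refl a (r * r) m (a * k * r + a * k * r))
      (+-congʳ (sym (expand-denominator a r k kk))))

    +-cancelʳ : ∀ {x y} z → x + z ≈ y + z → x ≈ y
    +-cancelʳ {x} {y} z eq =
      trans (sym (cancel z x)) (trans (+-congˡ (trans (+-comm z x) (trans eq (+-comm y z)))) (cancel z y))

    balance-below : ∀ a r k {m δ} → k * k ≈ a + m → a ≈ r * r + δ →
      a * ((r + k) * (r + k)) ≈ (a + k * r) * (a + k * r) + m * δ
    balance-below a r k {m} {δ} kk a≈ = +-cancelʳ (m * (r * r))
      (trans (sym (balance a r k kk)) (trans (+-congˡ (*-congˡ a≈))
      (solve 4 (λ n q m δ → n :+ m :* (q :+ δ) := n :+ m :* δ :+ m :* q)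
        refl ((a + k * r) * (a + k * r)) (r * r) m δ)))

    balance-above : ∀ a r k {m δ} → k * k ≈ a + m → r * r ≈ a + δ →
      (a + k * r) * (a + k * r) ≈ a * ((r + k) * (r + k)) + m * δ
    balance-above a r k {m} {δ} kk rr≈ = +-cancelʳ (m * a)
      (trans (balance a r k kk) (trans (+-congˡ (*-congˡ rr≈))
      (solve 4 (λ n a m δ → n :+ m :* (a :+ δ) := n :+ m :* δ :+ m :* a)
        refl (a * ((r + k) * (r + k))) a m δ)))

    square-step : ∀ n i → n * i * (n * i) ≈ n * n * (i * i)
    square-step = solve 2 (λ n i → n :* i :* (n :* i) := n :* n :* (i :* i)) refl

    regroup : ∀ a D i → a * (D * D) * (i * i) ≈ a * D * i * D * i
    regroup = solve 3 (λ a D i → a :* (D :* D) :* (i :* i) := a :* D :* i :* D :* i) refl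

    swap : ∀ δ D i → δ * D * i ≈ δ * i * D
    swap = solve 3 (λ δ D i → δ :* D :* i := δ :* i :* D) refl

    split-below : ∀ r k δ i → (r * r + δ + k * r) * i ≈ r * (r + k) * i + δ * i
    split-below = solve 4 (λ r k δ i → (r :* r :+ δ :+ k :* r) :* i
                                    := r :* (r :+ k) :* i :+ δ :* i) refl

    split-above : ∀ a r k δ i → (a + δ + k * r) * i ≈ (a + k * r) * i + δ * i
    split-above = solve 5 (λ a r k δ i → (a :+ δ :+ k :* r) :* i
                                      := (a :+ k :* r) :* i :+ δ :* i) refl

    factor : ∀ r k i → r * (r + k) * i ≈ (r * r + k * r) * i
    factor = solve 3 (λ r k i → r :* (r :+ k) :* i := (r :* r :+ k :* r) :* i) refl

    square-suc : ∀ a → (1# + a) * (1# + a) ≈ a + (1# + a + a * a)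
    square-suc = solve 1 (λ a → (con 1 :+ a) :* (con 1 :+ a)
                             := a :+ (con 1 :+ a :+ a :* a)) refl

    shift : ∀ r a → r + (1# + a) ≈ 1# + (r + a)
    shift = solve 2 (λ r a → r :+ (con 1 :+ a) := con 1 :+ (r :+ a)) refl

  RootCandidate : Carrier → Carrier → Set ℓ
  RootCandidate a s = 0# ≤ s × s * s ≤ a

  -- Let r = sup {s ≥ 0 ∣ s² ≤ a}.  With k = 1 + a, the number
  -- g = (a + kr) / (r + k) satisfies a - g² = (k² - a)(a - r²) / (r + k)² and
  -- g - r = (a - r²) / (r + k), so r² ≉ a would contradict the choice of r.
  private
    module Supremum
      (a r k m i : Carrier) (0≤a : 0# ≤ a) (0≤r : 0# ≤ r) (0≤k : 0# ≤ k) (0≤m : 0# ≤ m)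
      (0≤i : 0# ≤ i) (kk : k * k ≈ a + m) (Di≈1 : (r + k) * i ≈ 1#)
      (r-supremum : IsSupremum _≤_ (RootCandidate a) r)
      where

      D : Carrier
      D = r + k

      g : Carrier
      g = (a + k * r) * i
      0≤g : 0# ≤ g
      0≤g = *-nonNegative (+-nonNegative 0≤a (*-nonNegative 0≤k 0≤r)) 0≤i

      times-Di : ∀ x → x * D * i ≈ x
      times-Di x = trans (*-assoc x D i) (trans (*-congˡ Di≈1) (*-identityʳ x))

      gg : g * g ≈ (a + k * r) * (a + k * r) * (i * i)
      gg = square-step (a + k * r) i

      aDDii : a * (D * D) * (i * i) ≈ a
      aDDii = trans (regroup a D i) (trans (times-Di (a * D * i)) (times-Di a))

      vanish : ∀ {δ} → 0# ≤ δ → δ * i ≤ 0# → δ ≈ 0#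
      vanish {δ} 0≤δ δi≤0 = trans (sym (times-Di δ))
        (trans (swap δ D i)
        (trans (*-congʳ (antisym δi≤0 (*-nonNegative 0≤δ 0≤i))) (zeroˡ D)))

      gap : ∀ {δ} → 0# ≤ δ → 0# ≤ m * δ * (i * i)
      gap 0≤δ = *-nonNegative (*-nonNegative 0≤m 0≤δ) (*-nonNegative 0≤i 0≤i)

      rr≈a : r * r ≈ a
      rr≈a with total (r * r) a
      ... | inj₁ rr≤a with difference rr≤a
      ...   | δ , 0≤δ , a≈rr+δ = sym (trans a≈rr+δ (trans (+-congˡ δ≈0) (+-identityʳ (r * r))))
        where
        g≈ : g ≈ r + δ * i
        g≈ = trans (*-congʳ (+-congʳ a≈rr+δ))
          (trans (split-below r k δ i)
                 (+-congʳ (times-Di r)))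
        key : a * (D * D) ≈ (a + k * r) * (a + k * r) + m * δ
        key = balance-below a r k kk a≈rr+δ
        gg≤a : g * g ≤ a
        gg≤a = ≤-by (m * δ * (i * i)) (gap 0≤δ)
          (trans (sym aDDii) (trans (*-congʳ key) (trans (distribʳ _ _ _) (+-congʳ (sym gg)))))
        δ≈0 : δ ≈ 0#
        δ≈0 = vanish 0≤δ (+-cancelˡ-≤ r
          (≤-respˡ-≈ g≈ (≤-respʳ-≈ (sym (+-identityʳ r)) (proj₁ r-supremum g (0≤g , gg≤a)))))
      rr≈a | inj₂ a≤rr with difference a≤rr
      ...   | δ , 0≤δ , rr≈a+δ = trans rr≈a+δ (trans (+-congˡ δ≈0) (+-identityʳ a))
        where
        r≈ : r ≈ g + δ * i
        r≈ = trans (sym (times-Di r))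
          (trans (factor r k i) (trans (*-congʳ (+-congʳ rr≈a+δ)) (split-above a r k δ i)))
        key : (a + k * r) * (a + k * r) ≈ a * (D * D) + m * δ
        key = balance-above a r k kk rr≈a+δ
        a≤gg : a ≤ g * g
        a≤gg = ≤-by (m * δ * (i * i)) (gap 0≤δ)
          (trans gg (trans (*-congʳ key) (trans (distribʳ _ _ _) (+-congʳ aDDii))))
        δ≈0 : δ ≈ 0#
        δ≈0 = vanish 0≤δ (+-cancelˡ-≤ g (≤-respˡ-≈ r≈ (≤-respʳ-≈ (sym (+-identityʳ g))
          (proj₂ r-supremum g λ s (0≤s , ss≤a) → square-cancel-≤ 0≤g (≤-trans ss≤a a≤gg)))))

    0∈ : ∀ {a} → 0# ≤ a → RootCandidate a 0#
    0∈ 0≤a = ≤-refl , ≤-respˡ-≈ (sym (zeroˡ 0#)) 0≤a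

    0≤1+a : ∀ {a} → 0# ≤ a → 0# ≤ 1# + a
    0≤1+a = +-nonNegative 0≤1

    0≤1+a+aa : ∀ {a} → 0# ≤ a → 0# ≤ 1# + a + a * a
    0≤1+a+aa 0≤a = +-nonNegative (0≤1+a 0≤a) (*-nonNegative 0≤a 0≤a)

    bound : ∀ {a} → 0# ≤ a → IsUpperBound _≤_ (RootCandidate a) (1# + a)
    bound {a} 0≤a s (_ , ss≤a) = square-cancel-≤ (0≤1+a 0≤a)
      (≤-trans ss≤a (≤-by (1# + a + a * a) (0≤1+a+aa 0≤a) (square-suc a)))

    D≉0 : ∀ {a r} → 0# ≤ a → 0# ≤ r → ¬ r + (1# + a) ≈ 0#
    D≉0 {a} {r} 0≤a 0≤r D≈0 = 0≉1 (antisym 0≤1 (≤-respʳ-≈ D≈0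
      (≤-by (r + a) (+-nonNegative 0≤r 0≤a) (shift r a))))

    inverse-nonNegative : ∀ {x y} → 0# ≤ x → x * y ≈ 1# → 0# ≤ y
    inverse-nonNegative {x} {y} 0≤x xy≈1 = ≤-respʳ-≈
      (trans (sym (*-assoc x y y)) (trans (*-congʳ xy≈1) (*-identityˡ y)))
      (*-nonNegative 0≤x (square-nonNegative y))

  abstract
    sqrt : ∀ a → 0# ≤ a → ∃ λ r → 0# ≤ r × r * r ≈ a
    sqrt a 0≤a with complete (RootCandidate a) (0# , 0∈ 0≤a) (1# + a , bound 0≤a)
    ... | r , r-supremum with proj₁ r-supremum 0# (0∈ 0≤a)
    ...   | 0≤r with inverse (r + (1# + a)) (D≉0 0≤a 0≤r)
    ...     | i , Di≈1 = r , 0≤r , Supremum.rr≈a a r (1# + a) (1# + a + a * a) i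
        0≤a 0≤r (0≤1+a 0≤a) (0≤1+a+aa 0≤a)
        (inverse-nonNegative (+-nonNegative 0≤r (0≤1+a 0≤a)) Di≈1) (square-suc a) Di≈1 r-supremum

  √ : ∀ a → 0# ≤ a → Carrier
  √ a 0≤a = proj₁ (sqrt a 0≤a)

  -- ‖ x , y ‖ = √(x² + y²)
  ‖_,_‖ : Carrier → Carrier → Carrier
  ‖ x , y ‖ = √ (x * x + y * y) (sum-of-squares-nonNegative x y)

module FaultyStarter {ℓ : Level} (ℝ : RealNumbers ℓ) where
  open RealNumbers ℝ
  open SquareRoot ℝ using (‖_,_‖)

  Time Point : Set ℓ
  Time  = Carrier
  Point = Carrier × Carrier

  infix 4 _≋_

  _≋_ : Point → Point → Set ℓ
  (x , y) ≋ (x′ , y′) = x ≈ x′ × y ≈ y′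

  dist : Point → Point → Carrier
  dist (x , y) (x′ , y′) = ‖ x - x′ , y - y′ ‖

  S T : Point
  S = 0# , 0#
  T = 1# , 0#

  -- The position after time s ≥ 0 of a drone that leaves A at unit speed, flies
  -- straight to B and then stays there.
  straight : Point → Point → Time → Point
  straight A@(x , y) B@(x′ , y′) s =
    if ⌊ dist A B ≤? s ⌋
    then B
    else (x + s / dist A B * (x′ - x) , y + s / dist A B * (y′ - y))

  -- The position at time s of the starter failing at time t.
  starter : Time → Time → Point
  starter t s = s ⊓ t , 0#

  -- The finisher takes over the package at its first meeting with it at or after
  -- time `searchFrom`.  The unit speed limit is not part of the type; 𝓐₀ obeys it
  -- because it is composed of `straight` moves.
  record Plan : Set ℓ where
    field
      trajectory : Time → Point
      searchFrom : Time

  OnlineAlgorithm : Set ℓ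
  OnlineAlgorithm = Point → Plan

  module _ (𝓐 : OnlineAlgorithm) (P : Point) where
    open Plan (𝓐 P)

    CanHandOver : Time → Time → Set ℓ
    CanHandOver t h = 0# ≤ h × searchFrom ≤ h × trajectory h ≋ starter t h

    Carrying : Time → Time → Set ℓ
    Carrying t s = ∃ λ h → h ≤ s × CanHandOver t h

    AtTargetWithPackage : Time → Time → Set ℓ
    AtTargetWithPackage t s = Carrying t s × trajectory s ≋ T

    IsDeliveryTime : Time → Time → Set ℓ
    IsDeliveryTime t a =
      AtTargetWithPackage t a × (∀ s → AtTargetWithPackage t s → a ≤ s)

  Opt : Point → Time → Time
  Opt (x , y) t = 1# ⊔ (‖ x - t , y ‖ + 1# - t)

  IsFailTime : Time → Set ℓ
  IsFailTime t = 0# ≤ t × t ≤ 1#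

  -- A is the delivery time as a function of the fail time; its values outside
  -- [0,1] play no role.
  IsCompetitiveRatio : OnlineAlgorithm → Point → Carrier → Set ℓ
  IsCompetitiveRatio 𝓐 P ρ = ∃ λ (A : Time → Time) →
    (∀ t → IsFailTime t → IsDeliveryTime 𝓐 P t (A t)) ×
    IsSupremum _≤_ (λ q → ∃ λ t → IsFailTime t × q ≈ A t / Opt P t) ρ

  -- The finisher looks for the package only once it has reached S: a package it
  -- passes on the way from P to S (possible when y = 0) is left alone.
  𝓐₀ : OnlineAlgorithm
  𝓐₀ P = record
    { trajectory = λ s → if ⌊ dist P S ≤? s ⌋
                         then straight S T (s - dist P S)
                         else straight P S s
    ; searchFrom = dist P S
    }

{-# OPTIONS --safe #-}

-- The delivery time does not depend on the fail time t: the finisher reaches S at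
-- time ‖P‖, sweeps the whole segment ST and arrives at T at time ‖P‖ + 1.  By the
-- triangle inequality through (t , 0), Opt is smallest at t = 1, where it equals
-- max {1, ‖P - T‖}, so the supremum of the ratios is attained there.
module Submission where

open import Defs
open import Level using (Level)
import Algebra.Construct.NaturalChoice.Max as Max
import Algebra.Construct.NaturalChoice.Min as Min
import Algebra.Properties.Group as GroupProperties
import Algebra.Properties.Ring as RingProperties
import Algebra.Solver.Ring.NaturalCoefficients.Default as SemiringSolver
open import Data.Product.Base using (_,_; proj₁; proj₂)
open import Data.Sum.Base using (inj₁; inj₂)
open import Relation.Binary.Bundles using (TotalOrder)
import Relation.Binary.Reasoning.PartialOrder as PartialOrderReasoning
open import Relation.Nullary.Decidable.Core using (yes; no)
open import Relation.Nullary.Negation.Core using (¬_; contradiction)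

-- Order, inverses and squares in an ordered field.

module OrderedField {ℓ : Level} (ℝ : RealNumbers ℓ) where
  open RealNumbers ℝ
  open SquareRoot ℝ using (square-nonNegative)
  open RingProperties ring using (-0#≈0#; -‿distribˡ-*; -‿distribʳ-*; -‿involutive)
  open GroupProperties +-group using () renaming (//-rightDividesˡ to [y-x]+x≈y)
  open PartialOrderReasoning (TotalOrder.poset totalOrder)

  x-0≈x : ∀ x → x - 0# ≈ x
  x-0≈x x = trans (+-congˡ -0#≈0#) (+-identityʳ x)

  [x-y]+[y-z]≈x-z : ∀ x y z → (x - y) + (y - z) ≈ x - z
  [x-y]+[y-z]≈x-z x y z = trans (sym (+-assoc (x - y) y (- z))) (+-congʳ ([y-x]+x≈y y x))

  -x*-x≈x*x : ∀ x → - x * - x ≈ x * x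
  -x*-x≈x*x x = begin-equality
    - x * - x      ≈⟨ -‿distribˡ-* x (- x) ⟨
    - (x * - x)    ≈⟨ -‿cong (-‿distribʳ-* x x) ⟨
    - - (x * x)    ≈⟨ -‿involutive (x * x) ⟩
    x * x          ∎

  0≤1 : 0# ≤ 1#
  0≤1 = ≤-respʳ-≈ (*-identityˡ 1#) (square-nonNegative 1#)

  1≤x⇒x≉0 : ∀ {x} → 1# ≤ x → ¬ x ≈ 0#
  1≤x⇒x≉0 1≤x x≈0 = 0≉1 (antisym 0≤1 (≤-respʳ-≈ x≈0 1≤x))

  +-monoˡ-≤ : ∀ x {y z} → y ≤ z → y + x ≤ z + x
  +-monoˡ-≤ x {y} {z} y≤z = ≤-respˡ-≈ (+-comm x y) (≤-respʳ-≈ (+-comm x z) (+-monoʳ-≤ x y≤z))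

  x≤x+y : ∀ x {y} → 0# ≤ y → x ≤ x + y
  x≤x+y x 0≤y = ≤-respˡ-≈ (+-identityʳ x) (+-monoʳ-≤ x 0≤y)

  +-nonNegative : ∀ {x y} → 0# ≤ x → 0# ≤ y → 0# ≤ x + y
  +-nonNegative {x} 0≤x 0≤y = ≤-trans 0≤x (x≤x+y x 0≤y)

  x≤y⇒0≤y-x : ∀ {x y} → x ≤ y → 0# ≤ y - x
  x≤y⇒0≤y-x {x} x≤y = ≤-respˡ-≈ (-‿inverseʳ x) (+-monoˡ-≤ (- x) x≤y)

  *-monoˡ-≤ : ∀ {z} → 0# ≤ z → ∀ {x y} → x ≤ y → x * z ≤ y * z
  *-monoˡ-≤ {z} 0≤z {x} {y} x≤y = begin
    x * z                  ≤⟨ x≤x+y (x * z) (*-nonNegative (x≤y⇒0≤y-x x≤y) 0≤z) ⟩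
    x * z + (y - x) * z    ≈⟨ distribʳ z x (y - x) ⟨
    (x + (y - x)) * z      ≈⟨ *-congʳ (trans (+-comm x (y - x)) ([y-x]+x≈y x y)) ⟩
    y * z                  ∎

  *-monoʳ-≤ : ∀ {z} → 0# ≤ z → ∀ {x y} → x ≤ y → z * x ≤ z * y
  *-monoʳ-≤ {z} 0≤z {x} {y} x≤y =
    ≤-respˡ-≈ (*-comm x z) (≤-respʳ-≈ (*-comm y z) (*-monoˡ-≤ 0≤z x≤y))

  *-inverseʳ : ∀ {x} → ¬ x ≈ 0# → x * x ⁻¹ ≈ 1#
  -- The same test as in the definition of `_⁻¹`, so that `x ⁻¹` unfolds in each branch.
  *-inverseʳ {x} x≉0 with x ≟ 0#
  ... | yes x≈0  = contradiction x≈0 x≉0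
  ... | no  x≉0′ = proj₂ (inverse x x≉0′)

  x*[x⁻¹*y]≈y : ∀ {x} → ¬ x ≈ 0# → ∀ y → x * (x ⁻¹ * y) ≈ y
  x*[x⁻¹*y]≈y {x} x≉0 y =
    trans (sym (*-assoc x (x ⁻¹) y)) (trans (*-congʳ (*-inverseʳ x≉0)) (*-identityˡ y))

  *-cancelʳ : ∀ {z} → ¬ z ≈ 0# → ∀ {x y} → x * z ≈ y * z → x ≈ y
  *-cancelʳ {z} z≉0 {x} {y} xz≈yz = trans (sym (strip x)) (trans (*-congʳ xz≈yz) (strip y))
    where
    strip : ∀ w → w * z * z ⁻¹ ≈ w
    strip w = trans (*-assoc w z (z ⁻¹)) (trans (*-congˡ (*-inverseʳ z≉0)) (*-identityʳ w))

  -- The inverse is `x` times the square of `x ⁻¹`.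
  ⁻¹-nonNegative : ∀ {x} → 0# ≤ x → ¬ x ≈ 0# → 0# ≤ x ⁻¹
  ⁻¹-nonNegative {x} 0≤x x≉0 =
    ≤-respʳ-≈ (x*[x⁻¹*y]≈y x≉0 (x ⁻¹)) (*-nonNegative 0≤x (square-nonNegative (x ⁻¹)))

  -- Both inverses are multiples of `a ⁻¹ * b ⁻¹`, with factors `a` and `b`. The bound `1# ≤ a`
  -- keeps the denominators positive; it is the form in which `Opt`, a maximum with 1, supplies
  -- this.
  /-antitoneʳ-≤ : ∀ {n a b} → 0# ≤ n → 1# ≤ a → a ≤ b → n / b ≤ n / a
  /-antitoneʳ-≤ {n} {a} {b} 0≤n 1≤a a≤b = *-monoʳ-≤ 0≤n (begin
    b ⁻¹                 ≈⟨ x*[x⁻¹*y]≈y (1≤x⇒x≉0 1≤a) (b ⁻¹) ⟨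
    a * (a ⁻¹ * b ⁻¹)    ≤⟨ *-monoˡ-≤ (*-nonNegative (0≤⁻¹ 1≤a) (0≤⁻¹ 1≤b)) a≤b ⟩
    b * (a ⁻¹ * b ⁻¹)    ≈⟨ *-congˡ (*-comm (a ⁻¹) (b ⁻¹)) ⟩
    b * (b ⁻¹ * a ⁻¹)    ≈⟨ x*[x⁻¹*y]≈y (1≤x⇒x≉0 1≤b) (a ⁻¹) ⟩
    a ⁻¹                 ∎)
    where
    1≤b : 1# ≤ b
    1≤b = ≤-trans 1≤a a≤b
    0≤⁻¹ : ∀ {x} → 1# ≤ x → 0# ≤ x ⁻¹
    0≤⁻¹ 1≤x = ⁻¹-nonNegative (≤-trans 0≤1 1≤x) (1≤x⇒x≉0 1≤x)

  -- If `y ≤ x`, then xx ≤ yy ≤ yx ≤ xx, so xx = yx, and a nonzero `x` cancels.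
  square-cancel-≤ : ∀ {x y} → 0# ≤ y → x * x ≤ y * y → x ≤ y
  square-cancel-≤ {x} {y} 0≤y xx≤yy with total x y
  ... | inj₁ x≤y = x≤y
  ... | inj₂ y≤x with x ≟ 0#
  ...   | yes x≈0 = ≤-respˡ-≈ (sym x≈0) 0≤y
  ...   | no  x≉0 = ≤-reflexive (*-cancelʳ x≉0 (antisym
            (≤-trans xx≤yy (*-monoʳ-≤ 0≤y y≤x))
            (*-monoˡ-≤ (≤-trans 0≤y y≤x) y≤x)))

-- The Euclidean norm and a triangle inequality for horizontal shifts.

module Norm {ℓ : Level} (ℝ : RealNumbers ℓ) where
  open RealNumbers ℝ
  open SquareRoot ℝ
  open OrderedField ℝ
  open SemiringSolver commutativeSemiring using (solve; _:=_; _:+_; _:*_)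
  open PartialOrderReasoning (TotalOrder.poset totalOrder)

  -- Since `sqrt` is abstract, this sign and `‖‖-square` are all that is known of the norm.
  ‖‖-nonNegative : ∀ x y → 0# ≤ ‖ x , y ‖
  ‖‖-nonNegative x y = proj₁ (proj₂ (sqrt (x * x + y * y) (sum-of-squares-nonNegative x y)))

  ‖‖-square : ∀ x y → ‖ x , y ‖ * ‖ x , y ‖ ≈ x * x + y * y
  ‖‖-square x y = proj₂ (proj₂ (sqrt (x * x + y * y) (sum-of-squares-nonNegative x y)))

  ‖‖-least : ∀ {x y r} → 0# ≤ r → x * x + y * y ≤ r * r → ‖ x , y ‖ ≤ r
  ‖‖-least {x} {y} 0≤r le = square-cancel-≤ 0≤r (≤-respˡ-≈ (sym (‖‖-square x y)) le)

  ‖‖-unique : ∀ {x y r} → 0# ≤ r → r * r ≈ x * x + y * y → ‖ x , y ‖ ≈ r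
  ‖‖-unique {x} {y} 0≤r rr≈ = antisym
    (‖‖-least 0≤r (≤-reflexive (sym rr≈)))
    (square-cancel-≤ (‖‖-nonNegative x y) (≤-reflexive (trans rr≈ (sym (‖‖-square x y)))))

  -- The root comes from an abstract supremum, so it respects `_≈_` only through uniqueness of the
  -- nonnegative root.
  ‖‖-cong : ∀ {x x′ y y′} → x ≈ x′ → y ≈ y′ → ‖ x , y ‖ ≈ ‖ x′ , y′ ‖
  ‖‖-cong {x′ = x′} {y′ = y′} x≈x′ y≈y′ = ‖‖-unique (‖‖-nonNegative x′ y′)
    (trans (‖‖-square x′ y′) (sym (+-cong (*-cong x≈x′ x≈x′) (*-cong y≈y′ y≈y′))))

  -x≤‖x,y‖ : ∀ x y → - x ≤ ‖ x , y ‖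
  -x≤‖x,y‖ x y = square-cancel-≤ (‖‖-nonNegative x y) (begin
    - x * - x                ≈⟨ -x*-x≈x*x x ⟩
    x * x                    ≤⟨ x≤x+y (x * x) (square-nonNegative y) ⟩
    x * x + y * y            ≈⟨ ‖‖-square x y ⟨
    ‖ x , y ‖ * ‖ x , y ‖    ∎)

  -- Gives the sign of the excess term in `horizontal-triangle`.
  0≤x+‖x,y‖ : ∀ x y → 0# ≤ x + ‖ x , y ‖
  0≤x+‖x,y‖ x y = ≤-respˡ-≈ (-‿inverseʳ x) (+-monoʳ-≤ x (-x≤‖x,y‖ x y))

  -- (‖(x + d , y)‖ + d)² = x² + y² + 2d(x + d + ‖(x + d , y)‖)
  horizontal-triangle : ∀ x y {d} → 0# ≤ d → ‖ x , y ‖ ≤ ‖ x + d , y ‖ + d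
  horizontal-triangle x y {d} 0≤d = ‖‖-least (+-nonNegative (‖‖-nonNegative (x + d) y) 0≤d) (begin
    x * x + y * y                                            ≤⟨ x≤x+y _ (+-nonNegative 0≤dw 0≤dw) ⟩
    x * x + y * y + (d * (x + d + u) + d * (x + d + u))      ≈⟨ collect x y d u ⟩
    ((x + d) * (x + d) + y * y) + (u * d + u * d + d * d)    ≈⟨ +-congʳ (‖‖-square (x + d) y) ⟨
    u * u + (u * d + u * d + d * d)                          ≈⟨ square-sum u d ⟩
    (u + d) * (u + d)                                        ∎)
    where
    u : Carrier
    u = ‖ x + d , y ‖
    0≤dw : 0# ≤ d * (x + d + u)
    0≤dw = *-nonNegative 0≤d (0≤x+‖x,y‖ (x + d) y)
    collect : ∀ x y d u → x * x + y * y + (d * (x + d + u) + d * (x + d + u))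
                        ≈ ((x + d) * (x + d) + y * y) + (u * d + u * d + d * d)
    collect = solve 4 (λ x y d u →
      x :* x :+ y :* y :+ (d :* (x :+ d :+ u) :+ d :* (x :+ d :+ u))
        := ((x :+ d) :* (x :+ d) :+ y :* y) :+ (u :* d :+ u :* d :+ d :* d)) refl
    square-sum : ∀ u d → u * u + (u * d + u * d + d * d) ≈ (u + d) * (u + d)
    square-sum = solve 2 (λ u d →
      u :* u :+ (u :* d :+ u :* d :+ d :* d) := (u :+ d) :* (u :+ d)) refl

-- The finisher's sweep, its delivery time and the competitive ratio.

module Delivery {ℓ : Level} (ℝ : RealNumbers ℓ) where
  open RealNumbers ℝ
  open SquareRoot ℝ
  open FaultyStarter ℝ
  open OrderedField ℝ
  open Norm ℝ
  open GroupProperties +-group using ()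
    renaming (//-rightDividesˡ to [y-x]+x≈y; //-rightDividesʳ to [y+x]-x≈y)
  open Max totalOrder using (x≤x⊔y; ⊔-monoʳ-≤)
  open Min totalOrder using (x≤y⇒y⊓x≈x)
  open PartialOrderReasoning (TotalOrder.poset totalOrder)

  ≋-trans : ∀ {A B C} → A ≋ B → B ≋ C → A ≋ C
  ≋-trans (p , q) (p′ , q′) = trans p p′ , trans q q′

  ≋-sym : ∀ {A B} → A ≋ B → B ≋ A
  ≋-sym (p , q) = sym p , sym q

  dist-ST≈1 : dist S T ≈ 1#
  dist-ST≈1 = ‖‖-unique 0≤1 (begin-equality
    1# * 1#                                          ≈⟨ -x*-x≈x*x 1# ⟨
    - 1# * - 1#                                      ≈⟨ *-cong (+-identityˡ (- 1#)) (+-identityˡ (- 1#)) ⟨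
    (0# - 1#) * (0# - 1#)                            ≈⟨ +-identityʳ _ ⟨
    (0# - 1#) * (0# - 1#) + 0#                       ≈⟨ +-congˡ (zeroˡ (0# - 0#)) ⟨
    (0# - 1#) * (0# - 1#) + 0# * (0# - 0#)           ≈⟨ +-congˡ (*-congʳ (-‿inverseʳ 0#)) ⟨
    (0# - 1#) * (0# - 1#) + (0# - 0#) * (0# - 0#)    ∎)

  -- Derived from the product of `dist S T` with its inverse, which avoids a congruence law for
  -- `_⁻¹`.
  [dist-ST]⁻¹≈1 : dist S T ⁻¹ ≈ 1#
  [dist-ST]⁻¹≈1 = begin-equality
    dist S T ⁻¹               ≈⟨ *-identityˡ _ ⟨
    1# * dist S T ⁻¹          ≈⟨ *-congʳ dist-ST≈1 ⟨
    dist S T * dist S T ⁻¹    ≈⟨ *-inverseʳ (1≤x⇒x≉0 (≤-reflexive (sym dist-ST≈1))) ⟩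
    1#                        ∎

  straight-ST : ∀ {r} → r ≤ 1# → straight S T r ≋ (r , 0#)
  straight-ST {r} r≤1 with dist S T ≤? r
  -- Here 1 ≤ `r` ≤ 1, so the resting point `T` is still `(r , 0#)`.
  ... | yes dist≤r = antisym (≤-respˡ-≈ dist-ST≈1 dist≤r) r≤1 , refl
  ... | no  _      =
    (begin-equality
      0# + r * dist S T ⁻¹ * (1# - 0#)    ≈⟨ +-identityˡ _ ⟩
      r * dist S T ⁻¹ * (1# - 0#)         ≈⟨ *-cong (*-congˡ [dist-ST]⁻¹≈1) (x-0≈x 1#) ⟩
      r * 1# * 1#                         ≈⟨ *-identityʳ _ ⟩
      r * 1#                              ≈⟨ *-identityʳ r ⟩
      r                                   ∎) ,
    (begin-equality
      0# + r * dist S T ⁻¹ * (0# - 0#)    ≈⟨ +-identityˡ _ ⟩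
      r * dist S T ⁻¹ * (0# - 0#)         ≈⟨ *-congˡ (-‿inverseʳ 0#) ⟩
      r * dist S T ⁻¹ * 0#                ≈⟨ zeroʳ _ ⟩
      0#                                  ∎)

  module _ (P : Point) where
    open Plan (𝓐₀ P)

    D : Carrier
    D = dist P S

    0≤D : 0# ≤ D
    0≤D = ‖‖-nonNegative _ _

    sweep : ∀ {s} → D ≤ s → s - D ≤ 1# → trajectory s ≋ (s - D , 0#)
    sweep {s} D≤s s-D≤1 with dist P S ≤? s
    ... | yes _   = straight-ST s-D≤1
    ... | no  D≰s = contradiction D≤s D≰s

    sweep-at : ∀ {t} → IsFailTime t → trajectory (t + D) ≋ (t , 0#)
    sweep-at {t} (0≤t , t≤1) = ≋-trans
      (sweep (≤-respˡ-≈ (+-identityˡ D) (+-monoˡ-≤ D 0≤t))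
             (≤-respˡ-≈ (sym ([y+x]-x≈y D t)) t≤1))
      ([y+x]-x≈y D t , refl)

    -- During the sweep the abscissa is `s - D`, so `T` is not reached before it equals 1. The
    -- restriction `D ≤ s` matters: a finisher starting on the ray beyond `T` meets `T` on its way
    -- to `S`.
    sweep-reaches-T : ∀ {s} → D ≤ s → trajectory s ≋ T → 1# ≤ s - D
    sweep-reaches-T {s} D≤s at-T with total 1# (s - D)
    ... | inj₁ 1≤s-D = 1≤s-D
    ... | inj₂ s-D≤1 = ≤-reflexive (proj₁ (≋-trans (≋-sym at-T) (sweep D≤s s-D≤1)))

    handover : ∀ {t} → IsFailTime t → CanHandOver 𝓐₀ P t (t + D)
    handover {t} fail@(0≤t , _) =
      +-nonNegative 0≤t 0≤D ,
      ≤-respˡ-≈ (+-identityˡ D) (+-monoˡ-≤ D 0≤t) ,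
      -- As `t ≤ t + D`, the starter has already stopped at `(t , 0#)` when the finisher gets there.
      ≋-trans (sweep-at fail) (sym (x≤y⇒y⊓x≈x (x≤x+y t 0≤D)) , refl)

    deliveryTime : ∀ t → IsFailTime t → IsDeliveryTime 𝓐₀ P t (1# + D)
    deliveryTime t fail@(_ , t≤1) =
      -- Taking fail time 1 in `sweep-at` yields the position at time `1# + D`, which is `T`.
      ((t + D , +-monoˡ-≤ D t≤1 , handover fail) , sweep-at (0≤1 , ≤-refl)) ,
      -- A handover happens no earlier than `searchFrom`, which is `D`, so any time with the package
      -- lies in the sweep or after it.
      λ { s ((h , h≤s , _ , D≤h , _) , at-T) →
          ≤-respʳ-≈ ([y-x]+x≈y D s)
            (+-monoˡ-≤ D (sweep-reaches-T (≤-trans D≤h h≤s) at-T)) }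

  1≤Opt : ∀ P t → 1# ≤ Opt P t
  1≤Opt P t = x≤x⊔y 1# _

  Opt-1≤ : ∀ x y → Opt (x , y) 1# ≤ 1# ⊔ ‖ x - 1# , y ‖
  Opt-1≤ x y = ⊔-monoʳ-≤ 1# (≤-reflexive ([y+x]-x≈y 1# ‖ x - 1# , y ‖))

  ≤Opt : ∀ x y {t} → t ≤ 1# → 1# ⊔ ‖ x - 1# , y ‖ ≤ Opt (x , y) t
  ≤Opt x y {t} t≤1 = ⊔-monoʳ-≤ 1# (begin
    -- The shift `1# - t` carries `x - 1#` to `x - t`.
    ‖ x - 1# , y ‖                            ≤⟨ horizontal-triangle (x - 1#) y (x≤y⇒0≤y-x t≤1) ⟩
    ‖ (x - 1#) + (1# - t) , y ‖ + (1# - t)    ≈⟨ +-congʳ (‖‖-cong ([x-y]+[y-z]≈x-z x 1# t) refl) ⟩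
    ‖ x - t , y ‖ + (1# - t)                  ≈⟨ +-assoc _ 1# (- t) ⟨
    ‖ x - t , y ‖ + 1# - t                    ∎)

  competitiveRatio : ∀ x y →
    IsCompetitiveRatio 𝓐₀ (x , y) ((1# + ‖ x , y ‖) / (1# ⊔ ‖ x - 1# , y ‖))
  competitiveRatio x y = (λ _ → 1# + D P) , deliveryTime P , upper , least
    where
    P : Point
    P = x , y
    1+D≈1+‖P‖ : 1# + D P ≈ 1# + ‖ x , y ‖
    1+D≈1+‖P‖ = +-congˡ (‖‖-cong (x-0≈x x) (x-0≈x y))
    0≤1+‖P‖ : 0# ≤ 1# + ‖ x , y ‖
    0≤1+‖P‖ = +-nonNegative 0≤1 (‖‖-nonNegative x y)
    upper : IsUpperBound _≤_ _ _
    upper q (t , (_ , t≤1) , q≈) = begin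
      q                                               ≈⟨ q≈ ⟩
      (1# + D P) / Opt P t                            ≈⟨ *-congʳ 1+D≈1+‖P‖ ⟩
      (1# + ‖ x , y ‖) / Opt P t                      ≤⟨ /-antitoneʳ-≤ 0≤1+‖P‖ (x≤x⊔y 1# _) (≤Opt x y t≤1) ⟩
      (1# + ‖ x , y ‖) / (1# ⊔ ‖ x - 1# , y ‖)        ∎
    least : ∀ c → IsUpperBound _≤_ _ c → _ ≤ c
    least c c-upper = begin
      -- The ratio at fail time 1 already forces the bound on `c`. Antitonicity changes the
      -- denominator, so the one-sided `Opt-1≤` suffices.
      (1# + ‖ x , y ‖) / (1# ⊔ ‖ x - 1# , y ‖)        ≤⟨ /-antitoneʳ-≤ 0≤1+‖P‖ (1≤Opt P 1#) (Opt-1≤ x y) ⟩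
      (1# + ‖ x , y ‖) / Opt P 1#                     ≈⟨ *-congʳ 1+D≈1+‖P‖ ⟨
      (1# + D P) / Opt P 1#                           ≤⟨ c-upper _ (1# , (0≤1 , ≤-refl) , refl) ⟩
      c                                               ∎

theorem1 : {ℓ : Level} (ℝ : RealNumbers ℓ) →
    let open RealNumbers ℝ
        open SquareRoot ℝ
        open FaultyStarter ℝ
    in (x y : Carrier) → 0# ≤ y →
       IsCompetitiveRatio 𝓐₀ (x , y) ((1# + ‖ x , y ‖) / (1# ⊔ ‖ x - 1# , y ‖))
theorem1 ℝ x y _ = Delivery.competitiveRatio ℝ x y
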